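{- Let $T$ be a grounded oriented tree, and let $U(T)=\{v\in V(T):\deg^-(v)\geq 2\}$. Suppose that the minimal subtree of $T$ containing the vertex set $U(T)$ is an out-arborescence. Then there exists an integer $d=d(T)$ such that every finite digraph $G$ with $\delta^+(G)\geq d$ contains $T$ as a subgraph.
   Context: All digraphs are finite, without loops or multiple copies of the same edge (two oppositely oriented edges between a pair of vertices are allowed). $\delta^+(G)$ is the minimum out-degree of $G$. An oriented tree is an orientation of an undirected tree. The height function of an oriented tree $T$ is a function $h_T\colon V(T)\to\mathbb{Z}$ with $h_T(v)=h_T(u)+1$ for every edge $(u,v)\in E(T)$. $T$ is grounded if $h_T$ is constant on the set of vertices of in-degree at least $2$. An out-arborescence is an oriented tree in which all edges are oriented away from a designated root vertex. -}

module Defs where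

open import Data.Nat using (ℕ; zero; suc; _+_; _≤_; _∸_)
open import Data.Integer as ℤ using (ℤ)
open import Data.Fin using (Fin)
open import Data.List using (List; map; allFin)
open import Data.Nat.ListAction using (sum)
open import Data.Empty using (⊥)
open import Data.Bool using (Bool; true; false; if_then_else_)
open import Data.Product using (Σ; ∃; _×_; _,_)
open import Data.Sum using (_⊎_)
open import Data.Unit using (⊤)
open import Function.Definitions using (Injective)
open import Relation.Binary.PropositionalEquality using (_≡_)

-- A digraph on vertex set Fin n, given by its (decidable) adjacency relation:
-- there is an edge (u , v) iff adj u v ≡ true.  Simple: no loops.  Two
-- oppositely oriented edges between a pair of vertices are allowed.
record Digraph : Set where
  field
    n        : ℕ
    adj      : Fin n → Fin n → Bool
    loopless : ∀ v → adj v v ≡ false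
open Digraph public

Edge : (G : Digraph) → Fin (n G) → Fin (n G) → Set
Edge G u v = adj G u v ≡ true

outdeg : (G : Digraph) → Fin (n G) → ℕ
outdeg G u = sum (map (λ v → if adj G u v then 1 else 0) (allFin (n G)))

indeg : (G : Digraph) → Fin (n G) → ℕ
indeg G v = sum (map (λ u → if adj G u v then 1 else 0) (allFin (n G)))

edgeCount : Digraph → ℕ
edgeCount G = sum (map (outdeg G) (allFin (n G)))

MinOutDegGeq : Digraph → ℕ → Set
MinOutDegGeq G d = ∀ u → d ≤ outdeg G u

data UWalk (G : Digraph) (P : Fin (n G) → Set) : Fin (n G) → Fin (n G) → Set where
  here : ∀ {v} → P v → UWalk G P v v
  fwd  : ∀ {u v w} → P u → Edge G u v → UWalk G P v w → UWalk G P u w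
  bwd  : ∀ {u v w} → P u → Edge G v u → UWalk G P v w → UWalk G P u w

data DWalk (G : Digraph) (P : Fin (n G) → Set) : Fin (n G) → Fin (n G) → Set where
  here : ∀ {v} → P v → DWalk G P v v
  fwd  : ∀ {u v w} → P u → Edge G u v → DWalk G P v w → DWalk G P u w

ConnectedOn : (G : Digraph) → (Fin (n G) → Set) → Set
ConnectedOn G P = ∀ u v → P u → P v → UWalk G P u v

record IsOrientedTree (T : Digraph) : Set where
  field
    nonempty  : 1 ≤ n T
    oriented  : ∀ u v → Edge T u v → adj T v u ≡ false
    connected : ConnectedOn T (λ _ → ⊤)
    edges     : edgeCount T ≡ n T ∸ 1

IsHeightFunction : (T : Digraph) → (Fin (n T) → ℤ) → Set
IsHeightFunction T h = ∀ u v → Edge T u v → h v ≡ h u ℤ.+ ℤ.+ 1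

InU : (T : Digraph) → Fin (n T) → Set
InU T v = 2 ≤ indeg T v

-- Grounded: the height function is constant on U(T).  (Height functions of a
-- tree are unique up to an additive constant, so "some" = "every".)
IsGrounded : Digraph → Set
IsGrounded T = Σ (Fin (n T) → ℤ) λ h →
  IsHeightFunction T h × (∀ u v → InU T u → InU T v → h u ≡ h v)

InMinSubtree : (T : Digraph) → Fin (n T) → Set
InMinSubtree T v = (X : Fin (n T) → Bool) →
  (∀ u → InU T u → X u ≡ true) →
  ConnectedOn T (λ w → X w ≡ true) →
  X v ≡ true

-- The subtree of T induced on vertex set S is an out-arborescence: there is a
-- root r ∈ S from which every vertex of S is reached by a directed path inside
-- S (all edges oriented away from r).  The empty subtree (U(T) = ∅) counts
-- as satisfying the condition.
IsOutArborescenceOn : (T : Digraph) → (Fin (n T) → Set) → Set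
IsOutArborescenceOn T S =
  (∀ v → S v → ⊥) ⊎ (Σ (Fin (n T)) λ r → S r × (∀ v → S v → DWalk T S r v))

ContainsSubgraph : (G T : Digraph) → Set
ContainsSubgraph G T = Σ (Fin (n T) → Fin (n G)) λ f →
  Injective _≡_ _≡_ f × (∀ u v → Edge T u v → Edge G (f u) (f v))

{-# OPTIONS --safe #-}
module Submission where

-- Let U be the set of vertices of T of in-degree at least 2.  A digraph G of large minimum
-- out-degree has a vertex v into which, for every small set F, there is a path of given length
-- avoiding F: make G out-regular of degree 2c, let W t v be the number of walks of length t
-- ending in v, and take (t , v) with t ≤ N maximising W t v * c ^ (N ∸ t).  All vertices then
-- carry, at the times shortly before t, boundedly many times the weight W t v (after
-- normalisation), so that a fixed vertex s lies on only an O(1/c) fraction of the W t v walks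
-- into v, and only an O(1/c) fraction of them revisits a vertex in the last steps.
--
-- Call such vertices rich of level 0, and a vertex rich of level i + 1 if it has many
-- out-neighbours that are rich of level i.  If a property occurs in every induced subgraph of
-- large minimum out-degree, so does the property of having many out-neighbours with it; hence
-- rich vertices of every level exist.
--
-- All vertices of U are reached by directed walks from one vertex r; moving r upwards, it may be
-- assumed to lie in U or to be a source.  As U lies on one height, T can be embedded greedily:
-- first the walks from r to U, sending a vertex at distance i above U to a rich vertex of level
-- i, and then the rest, where an edge entering the embedded part must end in U and starts a
-- directed path that is placed on one of the many paths into the image of its end vertex.

open import Defs
open import Data.Nat using (ℕ; zero; suc; _+_; _*_; _∸_; _^_; _≤_; _<_; z≤n; s≤s; NonZero; >-nonZero; >-nonZero⁻¹; _<?_; _≤?_)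
open import Data.Nat.Properties hiding (_≟_; suc-injective)
open import Data.Nat.Tactic.RingSolver using (solve-∀)
import Data.Nat.ListAction as ListAction
open import Data.Integer as ℤ using (ℤ)
import Data.Integer.Properties as ℤ
import Data.Integer.Tactic.RingSolver as ℤ
open import Algebra.Properties.Semiring.Sum +-*-semiring using (sum; sum-cong-≗; sum-replicate-zero; ∑-distrib-+; ∑-comm; *-distribˡ-sum; *-distribʳ-sum)
open import Data.Fin using (Fin; zero; suc; toℕ; fromℕ<)
open import Data.Fin.Properties using (_≟_; any?; all?; ¬∀⟶∃¬; injective⇒≤; toℕ-fromℕ<; toℕ<n)
open import Data.Bool using (Bool; true; false; if_then_else_; _∧_; not)
import Data.Bool.Properties as Bool
open import Data.List using (List; []; _∷_; length; map; filter; allFin; lookup; tabulate; concatMap)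
open import Data.List.Properties using (map-tabulate; length-map; length-++; length-tabulate)
open import Data.List.Membership.DecPropositional using (_∈?_)
open import Data.List.Membership.Propositional using (_∈_; _∉_; find; lose)
open import Data.List.Membership.Propositional.Properties using (∈-filter⁺; ∈-filter⁻; ∈-lookup; ∈-allFin; ∈-map⁺; ∈-map⁻; ∈-concatMap⁺)
open import Data.List.Membership.Setoid.Properties using (index-injective)
open import Data.List.Relation.Unary.Any as Any using (here; there; index)
open import Data.List.Relation.Unary.All as All using ([]; _∷_)
open import Data.List.Relation.Unary.AllPairs using ([]; _∷_)
open import Data.List.Relation.Unary.Unique.Propositional using (Unique)
open import Data.List.Relation.Unary.Unique.Propositional.Properties using (filter⁺; allFin⁺)
open import Data.Product using (Σ; ∃; ∃₂; _×_; _,_; proj₁; proj₂)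
open import Data.Product.Properties using (≡-dec)
open import Data.Sum using (_⊎_; inj₁; inj₂)
open import Data.Unit using (⊤; tt)
open import Data.Empty using (⊥-elim)
open import Function using (_∘_; id)
open import Relation.Nullary using (¬_; Dec; yes; no; does; contradiction; ¬?)
open import Relation.Nullary.Decidable using (_×-dec_; decidable-stable)
open import Relation.Binary.Definitions using (DecidableEquality)
open import Relation.Binary.PropositionalEquality using (_≡_; _≢_; refl; sym; trans; cong; cong₂; subst; setoid; module ≡-Reasoning)

-- Counting walks

⟦_⟧ : Bool → ℕ
⟦ b ⟧ = if b then 1 else 0

sum-zero : ∀ {n} {f : Fin n → ℕ} → (∀ i → f i ≡ 0) → sum f ≡ 0
sum-zero {n} f≡0 = trans (sum-cong-≗ f≡0) (sum-replicate-zero n)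

sum-mono : ∀ {n} {f g : Fin n → ℕ} → (∀ i → f i ≤ g i) → sum f ≤ sum g
sum-mono {zero}  _   = z≤n
sum-mono {suc n} f≤g = +-mono-≤ (f≤g zero) (sum-mono (λ i → f≤g (suc i)))

sum-mono-< : ∀ {n} {f g : Fin n → ℕ} → (∀ i → f i ≤ g i) → ∀ i → f i < g i → sum f < sum g
sum-mono-< f≤g zero    lt = +-mono-<-≤ lt (sum-mono (λ i → f≤g (suc i)))
sum-mono-< f≤g (suc i) lt = +-mono-≤-< (f≤g zero) (sum-mono-< (λ j → f≤g (suc j)) i lt)

term≤sum : ∀ {n} (f : Fin n → ℕ) i → f i ≤ sum f
term≤sum f zero    = m≤m+n _ _
term≤sum f (suc i) = ≤-trans (term≤sum (λ j → f (suc j)) i) (m≤n+m _ _)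

sum≤n*bound : ∀ {n} (f : Fin n → ℕ) {b} → (∀ i → f i ≤ b) → sum f ≤ n * b
sum≤n*bound {zero}  f f≤b = z≤n
sum≤n*bound {suc n} f f≤b = +-mono-≤ (f≤b zero) (sum≤n*bound (λ i → f (suc i)) (λ i → f≤b (suc i)))

sum-positive : ∀ {n} (f : Fin n → ℕ) → 0 < sum f → ∃ λ i → 0 < f i
sum-positive {suc n} f pos with f zero in eq
... | suc _ = zero , subst (0 <_) (sym eq) (s≤s z≤n)
... | zero with sum-positive (λ i → f (suc i)) pos
...   | i , 0<fi = suc i , 0<fi

restrict : ∀ {n} → Fin n → (Fin n → ℕ) → Fin n → ℕ
restrict s φ u = if does (s ≟ u) then φ u else 0

sum-restrict : ∀ {n} (s : Fin n) (φ : Fin n → ℕ) → sum (restrict s φ) ≤ φ s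
sum-restrict {suc n} zero φ =
  ≤-reflexive (trans (cong (φ zero +_) (sum-zero {n} (λ _ → refl))) (+-identityʳ _))
sum-restrict {suc n} (suc s) φ = sum-restrict s (λ i → φ (suc i))

argmax : ∀ {n} (f : Fin n → ℕ) → Fin n → ∃ λ i → ∀ j → f j ≤ f i
argmax {suc zero} f _ = zero , λ { zero → ≤-refl }
argmax {suc (suc n)} f _ with argmax (λ i → f (suc i)) zero
... | i , max with f zero ≤? f (suc i)
...   | yes p = suc i , λ where
                  zero    → p
                  (suc j) → max j
...   | no ¬p = zero , λ where
                  zero    → ≤-refl
                  (suc j) → ≤-trans (max j) (<⇒≤ (≰⇒> ¬p))

-- This makes the out-degrees exactly equal, so that the total number of walks of each length is
-- known and not merely bounded.
trim : ∀ {n} (p : Fin n → Bool) d → d ≤ sum (λ i → ⟦ p i ⟧) →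
  Σ (Fin n → Bool) λ q → (∀ i → q i ≡ true → p i ≡ true) × sum (λ i → ⟦ q i ⟧) ≡ d
trim {zero} p .zero z≤n = p , (λ _ e → e) , refl
trim {suc n} p zero _ = (λ _ → false) , (λ _ ()) , sum-zero {n} (λ _ → refl)
trim {suc n} p (suc d) d≤ with p zero in eq
... | true with trim (λ i → p (suc i)) d (≤-pred d≤)
...   | q , q⇒p , ∑q = (λ { zero → true ; (suc i) → q i }) , (λ { zero _ → eq ; (suc i) → q⇒p i }) , cong suc ∑q
trim {suc n} p (suc d) d≤ | false with trim (λ i → p (suc i)) (suc d) d≤
...   | q , q⇒p , ∑q = (λ { zero → false ; (suc i) → q i }) , (λ { zero () ; (suc i) → q⇒p i }) , ∑q

-- The path is read backwards from its end `v`. Since `F` grows by the vertices already passed, one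
-- freshness test covers both avoiding `F` and not repeating a vertex. The end `v` itself may lie in
-- `F`.
data InPath {n : ℕ} (e : Fin n → Fin n → Bool) : ℕ → Fin n → List (Fin n) → Set where
  stop : ∀ {v F} → InPath e 0 v F
  step : ∀ {k v F} u → e u v ≡ true → u ∉ (v ∷ F) → InPath e k u (v ∷ F) → InPath e (suc k) v F

InPath-mono : ∀ {n} {e e′ : Fin n → Fin n → Bool} → (∀ u v → e u v ≡ true → e′ u v ≡ true) →
  ∀ {k v F} → InPath e k v F → InPath e′ k v F
InPath-mono e⇒e′ stop = stop
InPath-mono e⇒e′ (step u e u∉ p) = step u (e⇒e′ _ _ e) u∉ (InPath-mono e⇒e′ p)

⟦⟧≤1 : ∀ b → ⟦ b ⟧ ≤ 1
⟦⟧≤1 true  = ≤-refl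
⟦⟧≤1 false = z≤n

-- Weighted walks and their visits to given vertices

module Walks {n : ℕ} (a : Fin n → Fin n → Bool) where

  push : (Fin n → ℕ) → Fin n → ℕ
  push φ v = sum λ u → ⟦ a u v ⟧ * φ u

  push-mono : ∀ {φ ψ} → (∀ u → φ u ≤ ψ u) → ∀ v → push φ v ≤ push ψ v
  push-mono φ≤ψ v = sum-mono λ u → *-monoʳ-≤ ⟦ a u v ⟧ (φ≤ψ u)

  push-+ : ∀ φ ψ v → push (λ u → φ u + ψ u) v ≡ push φ v + push ψ v
  push-+ φ ψ v = trans (sum-cong-≗ (λ u → *-distribˡ-+ ⟦ a u v ⟧ (φ u) (ψ u)))
    (∑-distrib-+ (λ u → ⟦ a u v ⟧ * φ u) (λ u → ⟦ a u v ⟧ * ψ u))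

  push-* : ∀ k φ v → push (λ u → k * φ u) v ≡ k * push φ v
  push-* k φ v = trans (sum-cong-≗ (λ u → swap ⟦ a u v ⟧ k (φ u))) (sym (*-distribˡ-sum k (λ u → ⟦ a u v ⟧ * φ u)))
    where
    swap : ∀ x y z → x * (y * z) ≡ y * (x * z)
    swap = solve-∀

  push≤mass : ∀ φ v → push φ v ≤ sum φ
  push≤mass φ v = sum-mono λ u → ≤-trans (*-monoˡ-≤ (φ u) (⟦⟧≤1 (a u v))) (≤-reflexive (*-identityˡ _))

  mass-push : ∀ φ → sum (push φ) ≡ sum (λ u → sum (λ v → ⟦ a u v ⟧) * φ u)
  mass-push φ = trans (∑-comm (λ v u → ⟦ a u v ⟧ * φ u))
    (sum-cong-≗ (λ u → sym (*-distribʳ-sum (φ u) (λ v → ⟦ a u v ⟧))))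

  -- walks μ t v is the μ-weighted number of walks with t steps ending in v.
  walks : (Fin n → ℕ) → ℕ → Fin n → ℕ
  walks μ zero    = μ
  walks μ (suc t) = push (walks μ t)

  walks-+ : ∀ μ i t v → walks (walks μ t) i v ≡ walks μ (i + t) v
  walks-+ μ zero    t v = refl
  walks-+ μ (suc i) t v = sum-cong-≗ λ u → cong (⟦ a u v ⟧ *_) (walks-+ μ i t u)

  module Avoiding (d : ℕ) (deg≤ : ∀ u → sum (λ v → ⟦ a u v ⟧) ≤ d) (μ : Fin n → ℕ) where

    mass-push≤ : ∀ φ → sum (push φ) ≤ d * sum φ
    mass-push≤ φ = begin
      sum (push φ)                                ≡⟨ mass-push φ ⟩
      sum (λ u → sum (λ v → ⟦ a u v ⟧) * φ u)     ≤⟨ sum-mono (λ u → *-monoˡ-≤ (φ u) (deg≤ u)) ⟩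
      sum (λ u → d * φ u)                         ≡⟨ *-distribˡ-sum d φ ⟨
      d * sum φ                                   ∎
      where open ≤-Reasoning

    W : ℕ → Fin n → ℕ
    W = walks μ

    mutual
      -- The walks counted by W j y whose last j steps form a path avoiding F.
      good : ℕ → List (Fin n) → Fin n → ℕ
      good zero    F y = μ y
      good (suc j) F y = sum λ u → ⟦ a u y ⟧ * good′ j (y ∷ F) u

      good′ : ℕ → List (Fin n) → Fin n → ℕ
      good′ j F u = if does (_∈?_ _≟_ u F) then 0 else good j F u

    good′-positive : ∀ j F u → 0 < good′ j F u → u ∉ F × 0 < good j F u
    good′-positive j F u pos with _∈?_ _≟_ u F
    ... | no u∉ = u∉ , pos

    good⇒InPath : ∀ j F y → 0 < good j F y → InPath a j y F
    good⇒InPath zero    F y _ = stop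
    good⇒InPath (suc j) F y pos with sum-positive (λ u → ⟦ a u y ⟧ * good′ j (y ∷ F) u) pos
    ... | u , pos-u with a u y in auy
    ...   | true with good′-positive j (y ∷ F) u (subst (0 <_) (+-identityʳ _) pos-u)
    ...     | u∉ , pos-good = step u auy u∉ (good⇒InPath j (y ∷ F) u pos-good)

    -- hits s j y counts the walks to y that visit s at one of the j times before the last,
    -- with multiplicity.
    hits : Fin n → ℕ → Fin n → ℕ
    hits s zero    y = 0
    hits s (suc j) y = push (λ u → restrict s (W j) u + hits s j u) y

    hitsL : List (Fin n) → ℕ → Fin n → ℕ
    hitsL []      j y = 0
    hitsL (s ∷ F) j y = hits s j y + hitsL F j y

    -- S j = ∑_{i<j} d^(j-1-i) W i
    S : ℕ → Fin n → ℕ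
    S zero    y = 0
    S (suc j) y = W j y + d * S j y

    -- A walk that is at `s` at time `i` extends to time `j` in at most `d ^ (j - i)` ways; summing
    -- over `i ≤ j` gives the bound.
    mass-hits : ∀ s j → sum (λ u → restrict s (W j) u + hits s j u) ≤ S (suc j) s
    mass-hits s j = begin
      sum (λ u → restrict s (W j) u + hits s j u)  ≡⟨ ∑-distrib-+ (restrict s (W j)) (hits s j) ⟩
      sum (restrict s (W j)) + sum (hits s j)      ≤⟨ +-mono-≤ (sum-restrict s (W j)) (mass-hits′ j) ⟩
      W j s + d * S j s                            ∎
      where
      open ≤-Reasoning
      mass-hits′ : ∀ j → sum (hits s j) ≤ d * S j s
      mass-hits′ zero    = ≤-trans (≤-reflexive (sum-zero {n} (λ _ → refl))) z≤n
      mass-hits′ (suc j) = ≤-trans (mass-push≤ _) (*-monoʳ-≤ d (mass-hits s j))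

    hits≤S : ∀ s j y → hits s j y ≤ S j s
    hits≤S s zero    y = z≤n
    hits≤S s (suc j) y = ≤-trans (push≤mass _ y) (mass-hits s j)

    -- Pushing turns each `W i` into `W (suc i)`, which yields `S (suc j)` without its term for
    -- `i = 0`.
    push-S≤ : ∀ j y → push (S j) y ≤ S (suc j) y
    push-S≤ zero    y = ≤-trans (≤-reflexive (sum-zero (λ u → *-zeroʳ ⟦ a u y ⟧))) z≤n
    push-S≤ (suc j) y = begin
      push (λ u → W j u + d * S j u) y        ≡⟨ push-+ (W j) (λ u → d * S j u) y ⟩
      W (suc j) y + push (λ u → d * S j u) y  ≡⟨ cong (W (suc j) y +_) (push-* d (S j) y) ⟩
      W (suc j) y + d * push (S j) y          ≤⟨ +-monoʳ-≤ (W (suc j) y) (*-monoʳ-≤ d (push-S≤ j y)) ⟩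
      S (suc (suc j)) y                       ∎
      where open ≤-Reasoning

    -- Unlike `hitsL`, this also counts a visit to the list at the last time `j`, that is, at `u`
    -- itself.
    hitsL⁺ : List (Fin n) → ℕ → Fin n → ℕ
    hitsL⁺ []      j u = 0
    hitsL⁺ (s ∷ F) j u = (restrict s (W j) u + hits s j u) + hitsL⁺ F j u

    push-hitsL⁺ : ∀ F j y → push (hitsL⁺ F j) y ≤ hitsL F (suc j) y
    push-hitsL⁺ []      j y = ≤-reflexive (sum-zero (λ u → *-zeroʳ ⟦ a u y ⟧))
    push-hitsL⁺ (s ∷ F) j y = ≤-trans (≤-reflexive (push-+ (λ u → restrict s (W j) u + hits s j u) (hitsL⁺ F j) y))
      (+-monoʳ-≤ _ (push-hitsL⁺ F j y))

    hitsL≤hitsL⁺ : ∀ F j u → hitsL F j u ≤ hitsL⁺ F j u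
    hitsL≤hitsL⁺ []      j u = z≤n
    hitsL≤hitsL⁺ (s ∷ F) j u = +-mono-≤ (m≤n+m _ _) (hitsL≤hitsL⁺ F j u)

    restrict-here : ∀ (s : Fin n) φ → φ s ≤ restrict s φ s
    restrict-here s φ with s ≟ s
    ... | yes _ = ≤-refl
    ... | no ¬p = contradiction refl ¬p

    W≤hitsL⁺ : ∀ {F u} j → u ∈ F → W j u ≤ hitsL⁺ F j u
    W≤hitsL⁺ {s ∷ F} j (here refl) = ≤-trans (restrict-here s (W j)) (≤-trans (m≤m+n _ _) (m≤m+n _ _))
    W≤hitsL⁺ {s ∷ F} j (there u∈) = ≤-trans (W≤hitsL⁺ j u∈) (m≤n+m _ _)

    W≤good′+ : ∀ j F u {x} → (u ∈ F → W j u ≤ x) → W j u ≤ good j F u + x → W j u ≤ good′ j F u + x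
    W≤good′+ j F u if-∈ if-∉ with _∈?_ _≟_ u F
    ... | yes u∈ = if-∈ u∈
    ... | no _   = if-∉

    -- A walk whose last j steps do not form a path avoiding F either visits F or revisits
    -- a vertex; the revisits account for the term j * S j y.
    W≤good+hits : ∀ j F y → W j y ≤ good j F y + (hitsL F j y + j * S j y)
    W≤good+hits zero    F y = m≤m+n _ _
    W≤good+hits (suc j) F y = begin
      push (W j) y
        ≤⟨ push-mono bound y ⟩
      push (λ u → good′ j F′ u + (hitsL⁺ F′ j u + j * S j u)) y
        ≡⟨ push-+ (good′ j F′) _ y ⟩
      good (suc j) F y + push (λ u → hitsL⁺ F′ j u + j * S j u) y
        ≡⟨ cong (good (suc j) F y +_) (push-+ (hitsL⁺ F′ j) _ y) ⟩
      good (suc j) F y + (push (hitsL⁺ F′ j) y + push (λ u → j * S j u) y)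
        ≤⟨ +-monoʳ-≤ (good (suc j) F y) (+-mono-≤ (push-hitsL⁺ F′ j y)
             (≤-trans (≤-reflexive (push-* j (S j) y)) (*-monoʳ-≤ j (push-S≤ j y)))) ⟩
      good (suc j) F y + ((hits y (suc j) y + hitsL F (suc j) y) + j * S (suc j) y)
        -- The earlier visits to `y` are the revisits of the end vertex; bounding them by
        -- `S (suc j) y` raises the factor `j` to `suc j`.
        ≤⟨ +-monoʳ-≤ (good (suc j) F y) (+-monoˡ-≤ _ (+-monoˡ-≤ _ (hits≤S y (suc j) y))) ⟩
      good (suc j) F y + ((S (suc j) y + hitsL F (suc j) y) + j * S (suc j) y)
        ≡⟨ cong (good (suc j) F y +_) (rearrange (S (suc j) y) (hitsL F (suc j) y) _) ⟩
      good (suc j) F y + (hitsL F (suc j) y + suc j * S (suc j) y) ∎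
      where
      open ≤-Reasoning
      F′ = y ∷ F
      rearrange : ∀ p q r → (p + q) + r ≡ q + (p + r)
      rearrange = solve-∀
      bound : ∀ u → W j u ≤ good′ j F′ u + (hitsL⁺ F′ j u + j * S j u)
      bound u = W≤good′+ j F′ u (λ u∈ → ≤-trans (W≤hitsL⁺ j u∈) (m≤m+n _ _))
        (≤-trans (W≤good+hits j F′ u) (+-monoʳ-≤ (good j F′ u) (+-monoˡ-≤ _ (hitsL≤hitsL⁺ F′ j u))))

    *-hitsL≤ : ∀ x F j y {b} → (∀ s → x * S j s ≤ b) → x * hitsL F j y ≤ length F * b
    *-hitsL≤ x []      j y S≤b = ≤-reflexive (*-zeroʳ x)
    *-hitsL≤ x (s ∷ F) j y S≤b = ≤-trans (≤-reflexive (*-distribˡ-+ x (hits s j y) (hitsL F j y)))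
      (+-mono-≤ (≤-trans (*-monoʳ-≤ x (hits≤S s j y)) (S≤b s)) (*-hitsL≤ x F j y S≤b))

  -- Paths into a vertex of dominating weight

  module _ (c : ℕ) (deg≤ : ∀ u → sum (λ v → ⟦ a u v ⟧) ≤ 2 * c) (μ : Fin n → ℕ) (k : ℕ) (v : Fin n)
    (dominates : ∀ i r → i + r ≡ k → ∀ s → c ^ r * walks μ i s ≤ walks μ k v) where

    open Avoiding (2 * c) deg≤ μ

    -- With `d = 2 * c` and `dominates`, the sum `S j s` times `c ^ suc r` is at most the geometric
    -- sum of `2 ^ i * W k v` over `i < j`, which is `(2 ^ j - 1) * W k v`. The extra `W k v` on the
    -- left replaces the subtraction.
    S-bound : ∀ j r → j + r ≡ k → ∀ s → c ^ suc r * S j s + W k v ≤ 2 ^ j * W k v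
    S-bound zero    r eq s = ≤-reflexive (cong₂ _+_ (*-zeroʳ (c ^ suc r)) (sym (+-identityʳ _)))
    S-bound (suc j) r eq s = begin
      c ^ suc r * (W j s + 2 * c * S j s) + W k v             ≡⟨ expand c (c ^ r) (W j s) (S j s) (W k v) ⟩
      (c ^ suc r * W j s + W k v) + 2 * (c ^ suc (suc r) * S j s)
        ≤⟨ +-monoˡ-≤ _ (+-monoˡ-≤ _ (dominates j (suc r) (trans (+-suc j r) eq) s)) ⟩
      (W k v + W k v) + 2 * (c ^ suc (suc r) * S j s)         ≡⟨ collect (W k v) (c ^ suc (suc r) * S j s) ⟩
      2 * (c ^ suc (suc r) * S j s + W k v)                   ≤⟨ *-monoʳ-≤ 2 (S-bound j (suc r) (trans (+-suc j r) eq) s) ⟩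
      2 * (2 ^ j * W k v)                                     ≡⟨ *-assoc 2 (2 ^ j) _ ⟨
      2 ^ suc j * W k v                                       ∎
      where
      open ≤-Reasoning
      expand : ∀ c p x y w → c * p * (x + 2 * c * y) + w ≡ (c * p * x + w) + 2 * (c * (c * p) * y)
      expand = solve-∀
      collect : ∀ w x → (w + w) + 2 * x ≡ 2 * (x + w)
      collect = solve-∀

    -- If no walk were good, all `w` walks would be counted by the error terms of `W≤good+hits`. By
    -- `S-bound`, `c` times these terms is at most `(length F + k) * 2 ^ k * w`, which is less than
    -- `c * w`.
    dominating⇒InPath : ∀ F → (length F + k) * 2 ^ k < c → 0 < walks μ k v → InPath a k v F
    dominating⇒InPath F big pos with good k F v in eq
    ... | suc _ = good⇒InPath k F v (subst (0 <_) (sym eq) (s≤s z≤n))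
    ... | zero  = contradiction w<w (<-irrefl refl)
      where
      open ≤-Reasoning
      w = W k v
      instance
        w≢0 : NonZero w
        w≢0 = >-nonZero pos
      c*S≤ : ∀ s → c * S k s ≤ 2 ^ k * w
      c*S≤ s = ≤-trans (≤-reflexive (cong (_* S k s) (sym (*-identityʳ c)))) (≤-trans (m≤m+n _ w) (S-bound k 0 (+-identityʳ k) s))
      swap : ∀ c k x → c * (k * x) ≡ k * (c * x)
      swap = solve-∀
      factor : ∀ l k x w → l * (x * w) + k * (x * w) ≡ ((l + k) * x) * w
      factor = solve-∀
      w<w : c * w < c * w
      w<w = begin-strict
        c * w
          ≤⟨ *-monoʳ-≤ c (≤-trans (W≤good+hits k F v) (≤-reflexive (cong (_+ (hitsL F k v + k * S k v)) eq))) ⟩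
        c * (hitsL F k v + k * S k v)                ≡⟨ *-distribˡ-+ c (hitsL F k v) (k * S k v) ⟩
        c * hitsL F k v + c * (k * S k v)            ≡⟨ cong (c * hitsL F k v +_) (swap c k (S k v)) ⟩
        c * hitsL F k v + k * (c * S k v)            ≤⟨ +-mono-≤ (*-hitsL≤ c F k v c*S≤) (*-monoʳ-≤ k (c*S≤ v)) ⟩
        length F * (2 ^ k * w) + k * (2 ^ k * w)     ≡⟨ factor (length F) k (2 ^ k) w ⟩
        ((length F + k) * 2 ^ k) * w                 <⟨ *-monoˡ-< w big ⟩
        c * w                                        ∎

^-distribʳ-* : ∀ o m n → (m * n) ^ o ≡ m ^ o * n ^ o
^-distribʳ-* zero    m n = refl
^-distribʳ-* (suc o) m n = trans (cong (m * n *_) (^-distribʳ-* o m n)) (interchange m n (m ^ o) (n ^ o))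
  where
  interchange : ∀ m n p q → m * n * (p * q) ≡ m * p * (n * q)
  interchange = solve-∀

n<2^n : ∀ n → n < 2 ^ n
n<2^n zero    = s≤s z≤n
n<2^n (suc n) = +-mono-≤ (m^n>0 2 n) (≤-trans (n<2^n n) (m≤m+n _ 0))

-- The time and vertex of maximal normalised weight

module _ {n : ℕ} (e : Fin n → Fin n → Bool) (k m c : ℕ) (big : (m + k) * 2 ^ k < c)
  (R : Fin n → Bool) (u₀ : Fin n) (u₀∈R : R u₀ ≡ true)
  (deg : ∀ u → R u ≡ true → 2 * c ≤ sum (λ v → ⟦ e u v ∧ R v ⟧)) where

  private
    -- A trimmed out-neighbourhood inside `R`. Vertices outside `R` receive the empty one, so that
    -- the upper bound `2 * c` holds at every vertex.
    Row : Fin n → Set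
    Row u = Σ (Fin n → Bool) λ q → (∀ v → q v ≡ true → e u v ≡ true × R v ≡ true)
      × (R u ≡ true → sum (λ v → ⟦ q v ⟧) ≡ 2 * c) × sum (λ v → ⟦ q v ⟧) ≤ 2 * c

    ∧-split : ∀ x y → x ∧ y ≡ true → x ≡ true × y ≡ true
    ∧-split true true _ = refl , refl

    row : ∀ u → Row u
    row u with R u in eq
    ... | false = (λ _ → false) , (λ _ ()) , (λ ()) , ≤-trans (≤-reflexive (sum-zero {n} (λ _ → refl))) z≤n
    ... | true with trim (λ v → e u v ∧ R v) (2 * c) (deg u eq)
    ...   | q , q⇒ , ∑q = q , (λ v qv → ∧-split (e u v) (R v) (q⇒ v qv)) , (λ _ → ∑q) , ≤-reflexive ∑q

    a : Fin n → Fin n → Bool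
    a u = proj₁ (row u)

    a⇒R : ∀ u v → a u v ≡ true → R v ≡ true
    a⇒R u v auv = proj₂ (proj₁ (proj₂ (row u)) v auv)

    open Walks a

    W : ℕ → Fin n → ℕ
    W = walks (λ u → ⟦ R u ⟧)

    mass : ℕ
    mass = sum (λ u → ⟦ R u ⟧)

    support : ∀ t u → 0 < W t u → R u ≡ true
    support zero u pos with R u
    ... | true = refl
    support (suc t) u pos with sum-positive (λ u′ → ⟦ a u′ u ⟧ * W t u′) pos
    ... | u′ , pos′ with a u′ u in eq
    ...   | true = a⇒R u′ u eq

    -- By `support` all weight stays in `R`, where `a` has out-degree exactly `2 * c`.
    mass-W : ∀ t → sum (W t) ≡ (2 * c) ^ t * mass
    mass-W zero    = sym (+-identityʳ _)
    mass-W (suc t) = begin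
      sum (push (W t))                              ≡⟨ mass-push (W t) ⟩
      sum (λ u → sum (λ v → ⟦ a u v ⟧) * W t u)     ≡⟨ sum-cong-≗ exact ⟩
      sum (λ u → 2 * c * W t u)                     ≡⟨ *-distribˡ-sum (2 * c) (W t) ⟨
      2 * c * sum (W t)                             ≡⟨ cong (2 * c *_) (mass-W t) ⟩
      2 * c * ((2 * c) ^ t * mass)                  ≡⟨ *-assoc (2 * c) ((2 * c) ^ t) mass ⟨
      (2 * c) ^ suc t * mass                        ∎
      where
      open ≡-Reasoning
      exact : ∀ u → sum (λ v → ⟦ a u v ⟧) * W t u ≡ 2 * c * W t u
      exact u with W t u in eq
      ... | zero  = trans (*-zeroʳ (sum (λ v → ⟦ a u v ⟧))) (sym (*-zeroʳ (2 * c)))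
      ... | suc w = cong (_* suc w) (proj₁ (proj₂ (proj₂ (row u))) (support t u (subst (0 <_) (sym eq) (s≤s z≤n))))

    instance
      c≢0 : NonZero c
      c≢0 = >-nonZero (≤-trans (s≤s z≤n) big)

      mass≢0 : NonZero mass
      mass≢0 = >-nonZero (≤-trans (≤-reflexive (cong ⟦_⟧ (sym u₀∈R))) (term≤sum (λ u → ⟦ R u ⟧) u₀))

    -- The surplus `n` over `k` makes `2 ^ horizon` exceed `n * 2 ^ k`, which forces the best time
    -- to be at least `k`.
    horizon : ℕ
    horizon = n + k

    peak : ℕ → Fin n
    peak t = proj₁ (argmax (W t) u₀)

    score : ℕ → Fin n → ℕ
    score t v = W t v * c ^ (horizon ∸ t)

    best : ∃ λ (t : Fin (suc horizon)) → ∀ t′ → score (toℕ t′) (peak (toℕ t′)) ≤ score (toℕ t) (peak (toℕ t))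
    best = argmax (λ t → score (toℕ t) (peak (toℕ t))) zero

    t : ℕ
    t = toℕ (proj₁ best)

    t≤horizon : t ≤ horizon
    t≤horizon = ≤-pred (toℕ<n (proj₁ best))

    v : Fin n
    v = peak t

    score-max : ∀ t′ s → t′ ≤ horizon → score t′ s ≤ score t v
    score-max t′ s t′≤ = ≤-trans (*-monoˡ-≤ (c ^ (horizon ∸ t′)) (proj₂ (argmax (W t′) u₀) s))
      (subst (λ x → score x (peak x) ≤ score t v) (toℕ-fromℕ< (s≤s t′≤)) (proj₂ best (fromℕ< (s≤s t′≤))))

    -- Averaging: at the horizon the score is the weight itself, the total is spread over `n`
    -- vertices, and none of them exceeds the best score.
    mass-horizon : (2 * c) ^ horizon * mass ≤ n * score t v
    mass-horizon = begin
      (2 * c) ^ horizon * mass   ≡⟨ mass-W horizon ⟨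
      sum (W horizon)            ≤⟨ sum≤n*bound (W horizon) W≤ ⟩
      n * score t v              ∎
      where
      open ≤-Reasoning
      W≤ : ∀ s → W horizon s ≤ score t v
      W≤ s = ≤-trans (≤-reflexive (trans (sym (*-identityʳ _)) (cong (λ x → W horizon s * c ^ x) (sym (n∸n≡0 horizon)))))
        (score-max horizon s ≤-refl)

    instance
      2c^≢0 : NonZero ((2 * c) ^ horizon)
      2c^≢0 = m^n≢0 (2 * c) horizon {{m*n≢0 2 c}}

    score>0 : 0 < n * score t v
    score>0 = ≤-trans (>-nonZero⁻¹ ((2 * c) ^ horizon * mass) {{m*n≢0 _ mass}}) mass-horizon

    W>0 : 0 < W t v
    W>0 with W t v | score>0
    ... | suc _ | _ = s≤s z≤n
    ... | zero  | p = contradiction (subst (0 <_) (*-zeroʳ n) p) (<-irrefl refl)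

    -- One vertex carries at most the total weight at time `t`. Against `mass-horizon` this shows
    -- that `t` cannot be small.
    score≤ : score t v ≤ 2 ^ t * (c ^ horizon * mass)
    score≤ = begin
      W t v * c ^ (horizon ∸ t)                        ≤⟨ *-monoˡ-≤ _ (term≤sum (W t) v) ⟩
      sum (W t) * c ^ (horizon ∸ t)                    ≡⟨ cong (_* c ^ (horizon ∸ t)) (mass-W t) ⟩
      (2 * c) ^ t * mass * c ^ (horizon ∸ t)           ≡⟨ cong (λ x → x * mass * c ^ (horizon ∸ t)) (^-distribʳ-* t 2 c) ⟩
      2 ^ t * c ^ t * mass * c ^ (horizon ∸ t)         ≡⟨ rearrange (2 ^ t) (c ^ t) mass (c ^ (horizon ∸ t)) ⟩
      2 ^ t * ((c ^ t * c ^ (horizon ∸ t)) * mass)     ≡⟨ cong (λ x → 2 ^ t * (x * mass)) (^-distribˡ-+-* c t (horizon ∸ t)) ⟨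
      2 ^ t * (c ^ (t + (horizon ∸ t)) * mass)         ≡⟨ cong (λ x → 2 ^ t * (c ^ x * mass)) (m+[n∸m]≡n t≤horizon) ⟩
      2 ^ t * (c ^ horizon * mass)                     ∎
      where
      open ≤-Reasoning
      rearrange : ∀ p q r s → p * q * r * s ≡ p * ((q * s) * r)
      rearrange = solve-∀

    2^horizon≤ : 2 ^ horizon ≤ n * 2 ^ t
    2^horizon≤ = *-cancelʳ-≤ _ _ (c ^ horizon * mass) {{m*n≢0 _ mass {{m^n≢0 c horizon}}}} (begin
      2 ^ horizon * (c ^ horizon * mass)   ≡⟨ *-assoc (2 ^ horizon) _ mass ⟨
      2 ^ horizon * c ^ horizon * mass     ≡⟨ cong (_* mass) (^-distribʳ-* horizon 2 c) ⟨
      (2 * c) ^ horizon * mass             ≤⟨ mass-horizon ⟩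
      n * score t v                        ≤⟨ *-monoʳ-≤ n score≤ ⟩
      n * (2 ^ t * (c ^ horizon * mass))   ≡⟨ *-assoc n (2 ^ t) _ ⟨
      n * 2 ^ t * (c ^ horizon * mass)     ∎)
      where open ≤-Reasoning

    k≤t : k ≤ t
    k≤t = ≮⇒≥ λ t<k → <-irrefl refl (begin-strict
      2 ^ horizon    ≤⟨ 2^horizon≤ ⟩
      n * 2 ^ t      ≤⟨ *-monoʳ-≤ n (^-monoʳ-≤ 2 (<⇒≤ t<k)) ⟩
      n * 2 ^ k      <⟨ *-monoˡ-< (2 ^ k) {{m^n≢0 2 k}} (n<2^n n) ⟩
      2 ^ n * 2 ^ k  ≡⟨ ^-distribˡ-+-* 2 n k ⟨
      2 ^ horizon    ∎)
      where open ≤-Reasoning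

    t₀ : ℕ
    t₀ = t ∸ k

    k+t₀≡t : k + t₀ ≡ t
    k+t₀≡t = m+[n∸m]≡n k≤t

    -- The last `k` steps before `t` are viewed as walks with initial weights `W t₀`. The claim is
    -- then the maximality of the score, with the common factor `c ^ (horizon ∸ t)` cancelled.
    dominates : ∀ i r → i + r ≡ k → ∀ s → c ^ r * walks (W t₀) i s ≤ walks (W t₀) k v
    dominates i r i+r≡k s = *-cancelʳ-≤ _ _ (c ^ (horizon ∸ t)) {{m^n≢0 c (horizon ∸ t)}} (begin
      c ^ r * walks (W t₀) i s * c ^ (horizon ∸ t)   ≡⟨ cong (λ x → c ^ r * x * c ^ (horizon ∸ t)) (walks-+ _ i t₀ s) ⟩
      c ^ r * W (i + t₀) s * c ^ (horizon ∸ t)       ≡⟨ rearrange (c ^ r) (W (i + t₀) s) (c ^ (horizon ∸ t)) ⟩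
      W (i + t₀) s * (c ^ r * c ^ (horizon ∸ t))     ≡⟨ cong (W (i + t₀) s *_) (^-distribˡ-+-* c r (horizon ∸ t)) ⟨
      W (i + t₀) s * c ^ (r + (horizon ∸ t))         ≡⟨ cong (λ x → W (i + t₀) s * c ^ x) exponent ⟩
      score (i + t₀) s
        ≤⟨ score-max (i + t₀) s (≤-trans (m≤m+n (i + t₀) r) (≤-trans (≤-reflexive time) t≤horizon)) ⟩
      score t v                                      ≡⟨ cong (λ x → W x v * c ^ (horizon ∸ t)) k+t₀≡t ⟨
      W (k + t₀) v * c ^ (horizon ∸ t)               ≡⟨ cong (_* c ^ (horizon ∸ t)) (walks-+ _ k t₀ v) ⟨
      walks (W t₀) k v * c ^ (horizon ∸ t)           ∎)
      where
      open ≤-Reasoning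
      rearrange : ∀ p q r → p * q * r ≡ q * (p * r)
      rearrange = solve-∀
      shuffle : ∀ i t r → (i + t) + r ≡ (i + r) + t
      shuffle = solve-∀
      time : (i + t₀) + r ≡ t
      time = trans (shuffle i t₀ r) (trans (cong (_+ t₀) i+r≡k) k+t₀≡t)
      exponent : r + (horizon ∸ t) ≡ horizon ∸ (i + t₀)
      exponent = trans (sym (m+n∸m≡n (i + t₀) (r + (horizon ∸ t))))
        (cong (_∸ (i + t₀)) (trans (sym (+-assoc (i + t₀) r _)) (trans (cong (_+ (horizon ∸ t)) time) (m+[n∸m]≡n t≤horizon))))

  ∃-many-InPaths : ∃ λ v → R v ≡ true × (∀ F → length F ≤ m → InPath e k v F)
  ∃-many-InPaths = v , support t v W>0 , λ F |F|≤m →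
    InPath-mono (λ u w auw → proj₁ (proj₁ (proj₂ (row u)) w auw))
      (dominating⇒InPath c (λ u → proj₂ (proj₂ (proj₂ (row u)))) (W t₀) k v dominates F
        (≤-trans (s≤s (*-monoˡ-≤ (2 ^ k) (+-monoˡ-≤ k |F|≤m))) big)
        (subst (0 <_) (sym (trans (walks-+ _ k t₀ v) (cong (λ x → W x v) k+t₀≡t))) W>0))

-- Unavoidable properties

lookup-injective : ∀ {A : Set} {xs : List A} → Unique xs → ∀ i j → lookup xs i ≡ lookup xs j → i ≡ j
lookup-injective (_  ∷ _) zero    zero    _  = refl
lookup-injective (x∉ ∷ _) zero    (suc j) eq = contradiction eq (All.lookup x∉ (∈-lookup j))
lookup-injective (x∉ ∷ _) (suc i) zero    eq = contradiction (sym eq) (All.lookup x∉ (∈-lookup i))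
lookup-injective (_  ∷ u) (suc i) (suc j) eq = cong suc (lookup-injective u i j eq)

unique-⊆⇒length≤ : ∀ {A : Set} {xs ys : List A} → Unique xs → (∀ {x} → x ∈ xs → x ∈ ys) → length xs ≤ length ys
unique-⊆⇒length≤ {A} {xs} u xs⊆ys = injective⇒≤ {f = λ i → index (xs⊆ys (∈-lookup i))} λ {i} {j} eq →
  lookup-injective u i j (index-injective (setoid A) (xs⊆ys (∈-lookup i)) (xs⊆ys (∈-lookup j)) eq)

unique-length< : ∀ {A : Set} (_≟A_ : DecidableEquality A) {xs ys : List A} →
  Unique xs → length ys < length xs → ∃ λ x → x ∈ xs × x ∉ ys
unique-length< _≟A_ {xs} {ys} u lt with Any.any? (λ x → ¬? (_∈?_ _≟A_ x ys)) xs
... | yes p = find p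
... | no ¬p = contradiction (unique-⊆⇒length≤ u xs⊆ys) (<⇒≱ lt)
  where
  xs⊆ys : ∀ {x} → x ∈ xs → x ∈ ys
  xs⊆ys {x} x∈ with _∈?_ _≟A_ x ys
  ... | yes x∈ys = x∈ys
  ... | no x∉ys = contradiction (lose x∈ x∉ys) ¬p

fresh∷unique : ∀ {A : Set} {x : A} {xs} → x ∉ xs → Unique xs → Unique (x ∷ xs)
fresh∷unique {xs = xs} x∉ u = All.tabulate (λ y∈ x≡y → x∉ (subst (_∈ xs) (sym x≡y) y∈)) ∷ u

unique-length≤n : ∀ {n} {xs : List (Fin n)} → Unique xs → length xs ≤ n
unique-length≤n {n} u = ≤-trans (unique-⊆⇒length≤ u (λ {x} _ → ∈-allFin x)) (≤-reflexive (length-tabulate {n = n} id))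

members : ∀ {n} → (Fin n → Bool) → List (Fin n)
members {n} p = filter (λ v → p v Bool.≟ true) (allFin n)

members-unique : ∀ {n} (p : Fin n → Bool) → Unique (members p)
members-unique {n} p = filter⁺ (λ v → p v Bool.≟ true) (allFin⁺ n)

∈-members⁻ : ∀ {n} (p : Fin n → Bool) {v} → v ∈ members p → p v ≡ true
∈-members⁻ {n} p v∈ = proj₂ (∈-filter⁻ (λ v → p v Bool.≟ true) {xs = allFin n} v∈)

∈-members⁺ : ∀ {n} (p : Fin n → Bool) {v} → p v ≡ true → v ∈ members p
∈-members⁺ p {v} pv = ∈-filter⁺ (λ v → p v Bool.≟ true) (∈-allFin v) pv

length-filter-sum : ∀ {A : Set} (p : A → Bool) xs →
  length (filter (λ v → p v Bool.≟ true) xs) ≡ ListAction.sum (map (λ v → ⟦ p v ⟧) xs)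
length-filter-sum p [] = refl
length-filter-sum p (x ∷ xs) with p x
... | true  = cong suc (length-filter-sum p xs)
... | false = length-filter-sum p xs

sum-allFin : ∀ {n} (f : Fin n → ℕ) → ListAction.sum (map f (allFin n)) ≡ sum f
sum-allFin f = trans (cong ListAction.sum (map-tabulate id f)) (sum-tabulate f)
  where
  sum-tabulate : ∀ {n} (f : Fin n → ℕ) → ListAction.sum (tabulate f) ≡ sum f
  sum-tabulate {zero}  f = refl
  sum-tabulate {suc n} f = cong (f zero +_) (sum-tabulate (f ∘ suc))

length-members : ∀ {n} (p : Fin n → Bool) → length (members p) ≡ sum (λ v → ⟦ p v ⟧)
length-members {n} p = trans (length-filter-sum p (allFin n)) (sum-allFin (λ v → ⟦ p v ⟧))

module _ {n : ℕ} (e : Fin n → Fin n → Bool) where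

  degIn : (Fin n → Bool) → Fin n → ℕ
  degIn R u = sum λ v → ⟦ e u v ∧ R v ⟧

  -- All vertex sets `R` are allowed, because `branching-unavoidable` applies the property to a
  -- shrinking subset.
  Unavoidable : (Fin n → Set) → ℕ → Set
  Unavoidable P d = ∀ R u₀ → R u₀ ≡ true → (∀ u → R u ≡ true → d ≤ degIn R u) →
    ∃ λ v → R v ≡ true × P v

  Branching : ℕ → (Fin n → Set) → Fin n → Set
  Branching D P v = Σ (List (Fin n)) λ L → Unique L × D ≤ length L × (∀ {w} → w ∈ L → e v w ≡ true × P w)

  -- Vertices with `P` are removed from `R` one at a time, as long as every vertex of `R` keeps `d`
  -- out-neighbours in the remainder `R′`. When some `u` in `R` fails this, at least `D` of its
  -- `d + D` out-neighbours have been removed, and all of these satisfy `P`.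
  branching-unavoidable : ∀ {P d} D → 1 ≤ d → Unavoidable P d → Unavoidable (Branching D P) (d + D)
  branching-unavoidable {P} {d} D 1≤d unavoidable R u₀ u₀∈R deg =
    go _ R (λ _ v∈R → v∈R) (λ v v∈R v∉R → contradiction (trans (sym v∈R) v∉R) λ ()) ≤-refl
    where
    Result : Set
    Result = ∃ λ v → R v ≡ true × Branching D P v

    -- The vertices of R outside R′ are the P-vertices found so far.
    go : ∀ fuel R′ → (∀ v → R′ v ≡ true → R v ≡ true) → (∀ v → R v ≡ true → R′ v ≡ false → P v) →
      sum (λ v → ⟦ R′ v ⟧) ≤ fuel → Result
    go fuel R′ R′⊆R found size with any? (λ u → (R u Bool.≟ true) ×-dec (degIn R′ u <? d))
    ... | yes (u , u∈R , few) = u , u∈R , members p , members-unique p , D≤ , λ w∈ → props (∈-members⁻ p w∈)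
      where
      p : Fin n → Bool
      p v = e u v ∧ (R v ∧ not (R′ v))
      split : ∀ x y z → ⟦ x ∧ y ⟧ ≤ ⟦ x ∧ z ⟧ + ⟦ x ∧ (y ∧ not z) ⟧
      split false y     z     = z≤n
      split true  false z     = z≤n
      split true  true  true  = ≤-refl
      split true  true  false = ≤-refl
      conj : ∀ x y z → x ∧ (y ∧ not z) ≡ true → x ≡ true × y ≡ true × z ≡ false
      conj true true false _ = refl , refl , refl
      props : ∀ {w} → p w ≡ true → e u w ≡ true × P w
      props {w} pw with conj (e u w) (R w) (R′ w) pw
      ... | euw , w∈R , w∉R′ = euw , found w w∈R w∉R′
      open ≤-Reasoning
      D≤ : D ≤ length (members p)
      D≤ = +-cancelˡ-≤ d D _ (begin
        d + D                                       ≤⟨ deg u u∈R ⟩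
        degIn R u                                   ≤⟨ sum-mono (λ v → split (e u v) (R v) (R′ v)) ⟩
        sum (λ v → ⟦ e u v ∧ R′ v ⟧ + ⟦ p v ⟧)      ≡⟨ ∑-distrib-+ (λ v → ⟦ e u v ∧ R′ v ⟧) (λ v → ⟦ p v ⟧) ⟩
        degIn R′ u + sum (λ v → ⟦ p v ⟧)            ≤⟨ +-monoˡ-≤ _ (<⇒≤ few) ⟩
        d + sum (λ v → ⟦ p v ⟧)                     ≡⟨ cong (d +_) (length-members p) ⟨
        d + length (members p)                      ∎)
    ... | no ¬few = next fuel size
      where
      many : ∀ u → R u ≡ true → d ≤ degIn R′ u
      many u u∈R = ≮⇒≥ λ few → ¬few (u , u∈R , few)
      -- Even if `u₀` has been removed, it still has at least `d ≥ 1` out-neighbours in `R′`.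
      nonempty : ∃ λ v → R′ v ≡ true
      nonempty with sum-positive (λ v → ⟦ e u₀ v ∧ R′ v ⟧) (≤-trans 1≤d (many u₀ u₀∈R))
      ... | v , pos with e u₀ v | R′ v in eq
      ...   | true | true = v , eq
      next : ∀ fuel → sum (λ v → ⟦ R′ v ⟧) ≤ fuel → Result
      next fuel size with nonempty
      ... | v₀ , v₀∈R′ with unavoidable R′ v₀ v₀∈R′ (λ u u∈R′ → many u (R′⊆R u u∈R′))
      ...   | v , v∈R′ , Pv = remove fuel size
        where
        R″ : Fin n → Bool
        R″ w = R′ w ∧ not (does (w ≟ v))
        R″⊆R′ : ∀ w → R″ w ≡ true → R′ w ≡ true
        R″⊆R′ w w∈ with R′ w
        ... | true = refl
        found″ : ∀ w → R w ≡ true → R″ w ≡ false → P w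
        found″ w w∈R w∉R″ with w ≟ v | R′ w in eq
        ... | yes refl | _     = Pv
        ... | no _     | false = found w w∈R eq
        le : ∀ w → ⟦ R″ w ⟧ ≤ ⟦ R′ w ⟧
        le w with R′ w
        ... | true  = ⟦⟧≤1 _
        ... | false = z≤n
        drop : ∀ b → b ≡ true → ⟦ b ∧ false ⟧ < ⟦ b ⟧
        drop true _ = s≤s z≤n
        lt : ⟦ R″ v ⟧ < ⟦ R′ v ⟧
        lt with v ≟ v
        ... | yes _ = drop (R′ v) v∈R′
        ... | no ¬p = contradiction refl ¬p
        smaller : sum (λ w → ⟦ R″ w ⟧) < sum (λ w → ⟦ R′ w ⟧)
        smaller = sum-mono-< le v lt
        remove : ∀ fuel → sum (λ w → ⟦ R′ w ⟧) ≤ fuel → Result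
        remove zero       size = contradiction (≤-trans smaller size) λ ()
        remove (suc fuel) size = go fuel R″ (λ w → R′⊆R w ∘ R″⊆R′ w) found″ (≤-pred (≤-trans smaller size))

  -- Here `m` will be the number of vertices of `T`: at most `m` images have to be avoided, so among
  -- `suc m` candidates one is free.
  Rich : ℕ → ℕ → Fin n → Set
  Rich m zero    v = ∀ F → length F ≤ m → InPath e m v F
  Rich m (suc i) v = Branching (suc m) (Rich m i) v

-- The base value is `2 * c` for the least `c` above `(m + m) * 2 ^ m`, as `∃-many-InPaths` demands
-- for `k = m`.
richBound : ℕ → ℕ → ℕ
richBound m zero    = 2 * suc ((m + m) * 2 ^ m)
richBound m (suc i) = richBound m i + suc m

1≤richBound : ∀ m i → 1 ≤ richBound m i
1≤richBound m zero    = s≤s z≤n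
1≤richBound m (suc i) = ≤-trans (1≤richBound m i) (m≤m+n _ _)

rich-unavoidable : ∀ {n} (e : Fin n → Fin n → Bool) m i → Unavoidable e (Rich e m i) (richBound m i)
rich-unavoidable e m zero    R u₀ u₀∈R deg = ∃-many-InPaths e m m _ ≤-refl R u₀ u₀∈R deg
rich-unavoidable e m (suc i) = branching-unavoidable e (suc m) (1≤richBound m i) (rich-unavoidable e m i)

-- Embedding the tree

unique-map-injective : ∀ {A B : Set} (f : A → B) {xs : List A} → Unique (map f xs) →
  ∀ {x y} → x ∈ xs → y ∈ xs → f x ≡ f y → x ≡ y
unique-map-injective f (_  ∷ _) (here refl) (here refl) _  = refl
unique-map-injective f (x∉ ∷ _) (here refl) (there y∈)  eq = contradiction eq (All.lookup x∉ (∈-map⁺ f y∈))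
unique-map-injective f (x∉ ∷ _) (there x∈)  (here refl) eq = contradiction (sym eq) (All.lookup x∉ (∈-map⁺ f x∈))
unique-map-injective f (_  ∷ u) (there x∈)  (there y∈)  eq = unique-map-injective f u x∈ y∈ eq

indeg≤1⇒unique : ∀ T {x y y′} → ¬ InU T x → Edge T y x → Edge T y′ x → y ≡ y′
indeg≤1⇒unique T {x} {y} {y′} x∉U yx y′x with y ≟ y′
... | yes eq = eq
... | no y≢y′ = contradiction
  (≤-trans (unique-⊆⇒length≤ {ys = members into} ((y≢y′ ∷ []) ∷ ([] ∷ [])) λ where
      (here refl)         → ∈-members⁺ into yx
      (there (here refl)) → ∈-members⁺ into y′x)
    (≤-reflexive (length-filter-sum into (allFin (n T))))) x∉U
  where
  into : Fin (n T) → Bool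
  into u = adj T u x

edgeList : (T : Digraph) → List (Fin (n T) × Fin (n T))
edgeList T = concatMap (λ u → map (u ,_) (members (adj T u))) (allFin (n T))

length-edgeList : ∀ T → length (edgeList T) ≡ edgeCount T
length-edgeList T = lengths (allFin (n T))
  where
  lengths : ∀ us → length (concatMap (λ u → map (u ,_) (members (adj T u))) us) ≡ ListAction.sum (map (outdeg T) us)
  lengths []       = refl
  lengths (u ∷ us) = trans (length-++ (map (u ,_) (members (adj T u))))
    (cong₂ _+_ (trans (length-map (u ,_) (members (adj T u))) (length-filter-sum (adj T u) (allFin (n T)))) (lengths us))

unique-edges≤edgeCount : ∀ T {es} → Unique es → (∀ {u v} → (u , v) ∈ es → Edge T u v) → length es ≤ edgeCount T
unique-edges≤edgeCount T u sound = ≤-trans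
  (unique-⊆⇒length≤ u λ { {x , y} e∈ → ∈-concatMap⁺ (λ u → map (u ,_) (members (adj T u)))
    (lose (∈-allFin x) (∈-map⁺ (x ,_) (∈-members⁺ (adj T x) (sound e∈)))) })
  (≤-reflexive (length-edgeList T))

crossing-edge : ∀ T {P x y} (D : List (Fin (n T))) → UWalk T P x y → x ∈ D → y ∉ D →
  ∃₂ λ u v → u ∈ D × v ∉ D × (Edge T u v ⊎ Edge T v u)
crossing-edge T D (here _) x∈ y∉ = contradiction x∈ y∉
crossing-edge T D (fwd {u} {v} _ e walk) x∈ y∉ with _∈?_ _≟_ v D
... | yes v∈ = crossing-edge T D walk v∈ y∉
... | no v∉  = u , v , x∈ , v∉ , inj₁ e
crossing-edge T D (bwd {u} {v} _ e walk) x∈ y∉ with _∈?_ _≟_ v D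
... | yes v∈ = crossing-edge T D walk v∈ y∉
... | no v∉  = u , v , x∈ , v∉ , inj₂ e

-- Partial embeddings grown vertex by vertex

module Embedding (T G : Digraph) where

  Assignment : Set
  Assignment = List (Fin (n T) × Fin (n G))

  dom : Assignment → List (Fin (n T))
  dom = map proj₁

  im : Assignment → List (Fin (n G))
  im = map proj₂

  -- Each new vertex is attached along one edge of `T`, and only this edge is required to be mapped
  -- to an edge of `G`. That no other edges of `T` remain is recovered at the end by counting.
  data Emb : Assignment → Set where
    root : ∀ x w → Emb ((x , w) ∷ [])
    out  : ∀ {ps x w y w′} → Emb ps → (x , w) ∈ ps → y ∉ dom ps → w′ ∉ im ps →
           Edge T x y → Edge G w w′ → Emb ((y , w′) ∷ ps)
    into : ∀ {ps x w y w′} → Emb ps → (x , w) ∈ ps → y ∉ dom ps → w′ ∉ im ps →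
           Edge T y x → Edge G w′ w → Emb ((y , w′) ∷ ps)

  dom-unique : ∀ {ps} → Emb ps → Unique (dom ps)
  dom-unique (root _ _)           = [] ∷ []
  dom-unique (out E _ y∉ _ _ _)  = fresh∷unique y∉ (dom-unique E)
  dom-unique (into E _ y∉ _ _ _) = fresh∷unique y∉ (dom-unique E)

  im-unique : ∀ {ps} → Emb ps → Unique (im ps)
  im-unique (root _ _)           = [] ∷ []
  im-unique (out E _ _ w∉ _ _)  = fresh∷unique w∉ (im-unique E)
  im-unique (into E _ _ w∉ _ _) = fresh∷unique w∉ (im-unique E)

  edges : ∀ {ps} → Emb ps → List (Fin (n T) × Fin (n T))
  edges (root _ _)                             = []
  edges (out {x = x} {y = y} E _ _ _ _ _)  = (x , y) ∷ edges E
  edges (into {x = x} {y = y} E _ _ _ _ _) = (y , x) ∷ edges E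

  length-edges : ∀ {ps} (E : Emb ps) → suc (length (edges E)) ≡ length ps
  length-edges (root _ _)          = refl
  length-edges (out E _ _ _ _ _)  = cong suc (length-edges E)
  length-edges (into E _ _ _ _ _) = cong suc (length-edges E)

  Realised : Assignment → Fin (n T) → Fin (n T) → Set
  Realised ps u v = Edge T u v × ∃₂ λ w w′ → (u , w) ∈ ps × (v , w′) ∈ ps × Edge G w w′

  weaken : ∀ {ps p u v} → Realised ps u v → Realised (p ∷ ps) u v
  weaken (e , w , w′ , u∈ , v∈ , e′) = e , w , w′ , there u∈ , there v∈ , e′

  edges-realised : ∀ {ps} (E : Emb ps) {u v} → (u , v) ∈ edges E → Realised ps u v
  edges-realised (out E x∈ _ _ e e′)  (here refl) = e , _ , _ , there x∈ , here refl , e′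
  edges-realised (into E x∈ _ _ e e′) (here refl) = e , _ , _ , here refl , there x∈ , e′
  edges-realised (out E _ _ _ _ _)    (there e∈)  = weaken (edges-realised E e∈)
  edges-realised (into E _ _ _ _ _)   (there e∈)  = weaken (edges-realised E e∈)

  edges-unique : ∀ {ps} (E : Emb ps) → Unique (edges E)
  edges-unique (root _ _) = []
  edges-unique (out E _ y∉ _ _ _) = fresh∷unique
    (λ e∈ → let (_ , _ , _ , _ , y∈ , _) = edges-realised E e∈ in y∉ (∈-map⁺ proj₁ y∈)) (edges-unique E)
  edges-unique (into E _ y∉ _ _ _) = fresh∷unique
    (λ e∈ → let (_ , _ , _ , y∈ , _ , _) = edges-realised E e∈ in y∉ (∈-map⁺ proj₁ y∈)) (edges-unique E)

  length≤n : ∀ {ps} → Emb ps → length ps ≤ n T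
  length≤n {ps} E = ≤-trans (≤-reflexive (sym (length-map proj₁ ps))) (unique-length≤n (dom-unique E))

  full⇒∈dom : ∀ {ps} → Emb ps → n T ≤ length ps → ∀ y → y ∈ dom ps
  full⇒∈dom {ps} E full y with _∈?_ _≟_ y (dom ps)
  ... | yes y∈ = y∈
  ... | no y∉  = contradiction
    (≤-trans (s≤s (≤-trans full (≤-reflexive (sym (length-map proj₁ ps))))) (unique-length≤n (fresh∷unique y∉ (dom-unique E))))
    (<-irrefl refl)

  -- A spanning Emb realises n - 1 distinct edges, hence all edges of the tree.
  spanning⇒contains : ∀ {ps} → IsOrientedTree T → Emb ps → (∀ y → y ∈ dom ps) → ContainsSubgraph G T
  spanning⇒contains {ps} tree E spanning = f , f-injective , f-edge
    where
    open IsOrientedTree tree using (nonempty) renaming (edges to edgeCount≡)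
    preimage : ∀ x → ∃ λ w → (x , w) ∈ ps
    preimage x with ∈-map⁻ proj₁ (spanning x)
    ... | (_ , w) , p∈ , refl = w , p∈
    f : Fin (n T) → Fin (n G)
    f x = proj₁ (preimage x)
    f∈ : ∀ x → (x , f x) ∈ ps
    f∈ x = proj₂ (preimage x)
    f-injective : ∀ {x y} → f x ≡ f y → x ≡ y
    f-injective {x} {y} eq = cong proj₁ (unique-map-injective proj₂ (im-unique E) (f∈ x) (f∈ y) eq)
    f-unique : ∀ {x w} → (x , w) ∈ ps → w ≡ f x
    f-unique {x} p∈ = cong proj₂ (unique-map-injective proj₁ (dom-unique E) p∈ (f∈ x) refl)
    n≤ps : n T ≤ length ps
    n≤ps = ≤-trans (≤-reflexive (sym (length-tabulate {n = n T} id)))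
      (≤-trans (unique-⊆⇒length≤ (allFin⁺ (n T)) (λ {y} _ → spanning y)) (≤-reflexive (length-map proj₁ ps)))
    covered : ∀ u v → Edge T u v → (u , v) ∈ edges E
    covered u v e = decidable-stable (_∈?_ (≡-dec _≟_ _≟_) (u , v) (edges E)) λ e∉ →
      let all-edges = unique-edges≤edgeCount T (fresh∷unique e∉ (edges-unique E)) λ where
            (here refl) → e
            (there e∈)  → proj₁ (edges-realised E e∈)
      in <-irrefl refl (≤-trans (≤-trans (≤-reflexive (m+[n∸m]≡n nonempty)) n≤ps)
           (≤-trans (≤-reflexive (sym (length-edges E))) (≤-trans all-edges (≤-reflexive edgeCount≡))))
    f-edge : ∀ u v → Edge T u v → Edge G (f u) (f v)
    f-edge u v e with edges-realised E (covered u v e)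
    ... | _ , w , w′ , u∈ , v∈ , e′ with f-unique u∈ | f-unique v∈
    ...   | refl | refl = e′

-- The greedy embedding

walkLength : ∀ {T P x y} → DWalk T P x y → ℕ
walkLength (here _)    = 0
walkLength (fwd _ _ w) = suc (walkLength w)

walk-height : ∀ {T P h} → IsHeightFunction T h → ∀ {x y} (w : DWalk T P x y) → h y ≡ h x ℤ.+ ℤ.+ walkLength w
walk-height isH (here _) = sym (ℤ.+-identityʳ _)
walk-height {h = h} isH {x} (fwd {v = v} _ e w) = trans (walk-height isH w)
  (trans (cong (ℤ._+ ℤ.+ walkLength w) (isH x v e)) (ℤ.+-assoc (h x) (ℤ.+ 1) (ℤ.+ walkLength w)))

module Greedy (T G : Digraph) (tree : IsOrientedTree T)
  (h : Fin (n T) → ℤ) (isH : IsHeightFunction T h) (H : ℤ) (h-U : ∀ u → InU T u → h u ≡ H)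
  (r : Fin (n T)) (reach : ∀ u → InU T u → DWalk T (λ _ → ⊤) r u)
  (r-top : InU T r ⊎ (∀ y → ¬ Edge T y r))
  (deg : ∀ u → suc (n T) ≤ outdeg G u)
  where

  open Embedding T G

  U? : ∀ x → Dec (InU T x)
  U? x = 2 ≤? indeg T x

  level : Fin (n T) → ℕ
  level x = ℤ.∣ H ℤ.- h x ∣

  -- Groundedness enters here: all walks from `x` to `U` have the same length, so a single level of
  -- richness at the image of `x` serves all of them.
  level-walk : ∀ {P x u} → InU T u → (w : DWalk T P x u) → level x ≡ walkLength w
  level-walk {x = x} {u} u∈U w = cong ℤ.∣_∣
    (trans (cong (ℤ._- h x) (trans (sym (h-U u u∈U)) (walk-height isH w))) (cancel (h x) (ℤ.+ walkLength w)))
    where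
    cancel : ∀ a b → (a ℤ.+ b) ℤ.- a ≡ b
    cancel = ℤ.solve-∀

  RichG : ℕ → Fin (n G) → Set
  RichG = Rich (adj G) (n T)

  -- The invariant of the embedding: an edge entering the embedded part `D` from outside can only
  -- end in `U`.
  Closed : List (Fin (n T)) → Fin (n T) → Set
  Closed D x = InU T x ⊎ (∀ y → Edge T y x → y ∈ D)

  Closed-mono : ∀ {D y x} → Closed D x → Closed (y ∷ D) x
  Closed-mono (inj₁ x∈U)    = inj₁ x∈U
  Closed-mono (inj₂ closed) = inj₂ λ y e → there (closed y e)

  -- Outside `U` a vertex has at most one in-neighbour, which is then the embedded `x`.
  parent⇒Closed : ∀ {D x y} → Edge T x y → x ∈ D → Closed D y
  parent⇒Closed {D} {x} {y} e x∈ with U? y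
  ... | yes y∈U = inj₁ y∈U
  ... | no y∉U  = inj₂ λ z e′ → subst (_∈ D) (indeg≤1⇒unique T y∉U e e′) x∈

  AllClosed : List (Fin (n T)) → Set
  AllClosed D = ∀ {x} → x ∈ D → Closed D x

  closed-∷ : ∀ {D x y} → AllClosed D → x ∈ D → Edge T x y → AllClosed (y ∷ D)
  closed-∷ closed x∈ e (here refl) = parent⇒Closed e (there x∈)
  closed-∷ closed x∈ e (there z∈)  = Closed-mono (closed z∈)

  fresh : ∀ {ps} → Emb ps → ∀ {L} → Unique L → suc (n T) ≤ length L → ∃ λ w → w ∈ L × w ∉ im ps
  fresh {ps} E u many = unique-length< _≟_ u (≤-trans (s≤s (≤-trans (≤-reflexive (length-map proj₂ ps)) (length≤n E))) many)

  record Core (ps : Assignment) : Set where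
    field
      emb    : Emb ps
      rich   : ∀ {x w} → (x , w) ∈ ps → RichG (level x) w
      closed : AllClosed (dom ps)

  embed-walk : ∀ {ps x w u} → Core ps → (x , w) ∈ ps → InU T u → DWalk T (λ _ → ⊤) x u →
    ∃ λ ps′ → Core ps′ × (∀ {z} → z ∈ dom ps → z ∈ dom ps′) × (∀ {p} → p ∈ ps → p ∈ ps′) × u ∈ dom ps′
  embed-walk {ps} C x∈ u∈U (here _) = ps , C , id , id , ∈-map⁺ proj₁ x∈
  embed-walk {ps} {x} {w} {u} C x∈ u∈U walk@(fwd {v = y} _ e rest) with _∈?_ _≟_ y (dom ps)
  ... | yes y∈ with ∈-map⁻ proj₁ y∈
  ...   | (_ , _) , p∈ , refl = embed-walk C p∈ u∈U rest
  embed-walk {ps} {x} {w} {u} C x∈ u∈U walk@(fwd {v = y} _ e rest) | no y∉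
    with subst (λ i → RichG i w) (trans (level-walk u∈U walk) (cong suc (sym (level-walk u∈U rest)))) (Core.rich C x∈)
  ... | L , L-unique , many , L-rich with fresh (Core.emb C) L-unique many
  ...   | w′ , w′∈L , w′∉ =
    let (ps′ , C′ , dom⊆ , ps⊆ , u∈) = embed-walk C⁺ (here refl) u∈U rest in ps′ , C′ , dom⊆ ∘ there , ps⊆ ∘ there , u∈
    where
    C⁺ : Core ((y , w′) ∷ ps)
    C⁺ = record
      { emb    = out (Core.emb C) x∈ y∉ w′∉ e (proj₁ (L-rich w′∈L))
      ; rich   = λ where
          (here refl) → proj₂ (L-rich w′∈L)
          (there p∈)  → Core.rich C p∈
      ; closed = closed-∷ (Core.closed C) (∈-map⁺ proj₁ x∈) e
      }

  embed-walks : ∀ {ps v₀} → Core ps → (r , v₀) ∈ ps → ∀ us →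
    ∃ λ ps′ → Core ps′ × (∀ {z} → z ∈ dom ps → z ∈ dom ps′) × (∀ {u} → u ∈ us → InU T u → u ∈ dom ps′)
  embed-walks {ps} C r∈ [] = ps , C , id , λ ()
  embed-walks {ps} C r∈ (u ∷ us) with U? u
  ... | no u∉U = let (ps′ , C′ , dom⊆ , us⊆) = embed-walks C r∈ us in ps′ , C′ , dom⊆ , λ where
      (here refl) u∈U → contradiction u∈U u∉U
      (there z∈)      → us⊆ z∈
  ... | yes u∈U with embed-walk C r∈ u∈U (reach u u∈U)
  ...   | ps₁ , C₁ , dom⊆₁ , ps⊆ , u∈ =
    let (ps′ , C′ , dom⊆ , us⊆) = embed-walks C₁ (ps⊆ r∈) us in ps′ , C′ , dom⊆ ∘ dom⊆₁ , λ where
      (here refl) _ → dom⊆ u∈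
      (there z∈)    → us⊆ z∈

  -- Once `U` is embedded, only the paths into the images of `U` are still drawn upon; `r` is kept
  -- as a starting point for finding crossing edges.
  record Base (ps : Assignment) : Set where
    field
      emb  : Emb ps
      U⊆   : ∀ {u} → InU T u → u ∈ dom ps
      legs : ∀ {u w} → InU T u → (u , w) ∈ ps → RichG 0 w
      r∈   : r ∈ dom ps

  base-∷ : ∀ {ps y w} → Base ps → y ∉ dom ps → Emb ((y , w) ∷ ps) → Base ((y , w) ∷ ps)
  base-∷ B y∉ E = record
    { emb  = E
    ; U⊆   = λ u∈U → there (Base.U⊆ B u∈U)
    ; legs = λ where
        u∈U (here refl) → contradiction (Base.U⊆ B u∈U) y∉
        u∈U (there p∈)  → Base.legs B u∈U p∈
    ; r∈   = there (Base.r∈ B)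
    }

  -- The leg is followed against its edges and placed on the path into `w`. Only its current start
  -- `x` may violate closedness. New vertices lie outside `U`, so the leg never forks, and it stops
  -- at a vertex without in-neighbours left to embed.
  attach-leg : ∀ {ps x w F} j → Base ps → (∀ {z} → z ∈ dom ps → z ≢ x → Closed (dom ps) z) →
    (x , w) ∈ ps → InPath (adj G) j w F → (∀ {w′} → w′ ∈ im ps → w′ ∈ w ∷ F) → n T ≤ length ps + j →
    ∀ y → Edge T y x → y ∉ dom ps →
    ∃ λ ps′ → Base ps′ × AllClosed (dom ps′) × length ps < length ps′
  -- The path in `G` can be used up only when all of `T` is embedded, and then no `y` is left.
  attach-leg {ps} zero B _ _ _ _ enough y _ y∉ =
    contradiction (full⇒∈dom (Base.emb B) (≤-trans enough (≤-reflexive (+-identityʳ _))) y) y∉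
  attach-leg {ps} {x} {w} {F} (suc j) B closed x∈ (step w′ e′ w′∉ path) im⊆ enough y e y∉
    = continue (any? (λ z → (adj T z y Bool.≟ true) ×-dec ¬? (_∈?_ _≟_ z (dom ps⁺))))
    where
    ps⁺ : Assignment
    ps⁺ = (y , w′) ∷ ps
    B⁺ : Base ps⁺
    B⁺ = base-∷ B y∉ (into (Base.emb B) x∈ y∉ (λ w′∈ → w′∉ (im⊆ w′∈)) e e′)
    closed⁺ : ∀ {z} → z ∈ dom ps⁺ → z ≢ y → Closed (dom ps⁺) z
    closed⁺ (here z≡y) z≢y = contradiction z≡y z≢y
    closed⁺ {z} (there z∈) _ with z ≟ x
    ... | yes refl = parent⇒Closed e (here refl)
    ... | no z≢x   = Closed-mono (closed z∈ z≢x)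
    im⊆⁺ : ∀ {v} → v ∈ im ps⁺ → v ∈ w′ ∷ w ∷ F
    im⊆⁺ (here eq)  = here eq
    im⊆⁺ (there v∈) = there (im⊆ v∈)
    continue : Dec (∃ λ z → Edge T z y × z ∉ dom ps⁺) → ∃ λ ps′ → Base ps′ × AllClosed (dom ps′) × length ps < length ps′
    continue (yes (z , e″ , z∉)) =
      let (ps′ , B′ , closed′ , longer) = attach-leg j B⁺ closed⁺ (here refl) path im⊆⁺
            (≤-trans enough (≤-reflexive (+-suc (length ps) j))) z e″ z∉
      in ps′ , B′ , closed′ , <-trans ≤-refl longer
    continue (no none) = ps⁺ , B⁺ , all-closed , ≤-refl
      where
      all-closed : AllClosed (dom ps⁺)
      all-closed {z} z∈ with z ≟ y
      ... | no z≢y   = closed⁺ z∈ z≢y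
      ... | yes refl = inj₂ λ v e″ → decidable-stable (_∈?_ _≟_ v (dom ps⁺)) λ v∉ → none (v , e″ , v∉)

  complete : ∀ fuel {ps} → Base ps → AllClosed (dom ps) → n T ≤ length ps + fuel → ContainsSubgraph G T
  complete fuel {ps} B closed enough with all? (λ y → _∈?_ _≟_ y (dom ps))
  ... | yes spanning = spanning⇒contains tree (Base.emb B) spanning
  complete zero {ps} B closed enough | no ¬spanning =
    contradiction (full⇒∈dom (Base.emb B) (≤-trans enough (≤-reflexive (+-identityʳ _)))) ¬spanning
  complete (suc fuel) {ps} B closed enough | no ¬spanning
    with ¬∀⟶∃¬ (n T) _ (λ y → _∈?_ _≟_ y (dom ps)) ¬spanning
  ... | y₀ , y₀∉ with crossing-edge T (dom ps) (IsOrientedTree.connected tree r y₀ tt tt) (Base.r∈ B) y₀∉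
  ... | x , y , x∈ , y∉ , inj₁ e with ∈-map⁻ proj₁ x∈ | fresh (Base.emb B) (members-unique (adj G (image x∈))) (many x∈)
    where
    image : x ∈ dom ps → Fin (n G)
    image x∈ = proj₂ (proj₁ (∈-map⁻ proj₁ x∈))
    many : ∀ x∈ → suc (n T) ≤ length (members (adj G (image x∈)))
    many x∈ = ≤-trans (deg (image x∈)) (≤-reflexive (sym (length-filter-sum (adj G (image x∈)) (allFin (n G)))))
  ...   | (_ , w) , p∈ , refl | w′ , w′∈ , w′∉ =
    complete fuel (base-∷ B y∉ (out (Base.emb B) p∈ y∉ w′∉ e (∈-members⁻ (adj G w) w′∈)))
      (closed-∷ closed x∈ e) (≤-trans enough (≤-reflexive (+-suc (length ps) fuel)))
  complete (suc fuel) {ps} B closed enough | no ¬spanning | y₀ , y₀∉ | x , y , x∈ , y∉ , inj₂ e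
    with closed x∈ | ∈-map⁻ proj₁ x∈
  ... | inj₂ x-closed | _ = contradiction (x-closed y e) y∉
  ... | inj₁ x∈U | (_ , w) , p∈ , refl with
    attach-leg (n T) B (λ z∈ _ → closed z∈) p∈
      -- The path avoids all images so far; its end `w` is one of them, which `InPath` permits.
      (Base.legs B x∈U p∈ (im ps) (≤-trans (≤-reflexive (length-map proj₂ ps)) (length≤n (Base.emb B))))
      there (m≤n+m (n T) (length ps)) y e y∉
  ...   | ps′ , B′ , closed′ , longer = complete fuel B′ closed′
    (≤-trans enough (≤-trans (≤-reflexive (+-suc (length ps) fuel)) (+-monoˡ-≤ fuel longer)))

  rich-root⇒contains : ∀ v₀ → RichG (level r) v₀ → ContainsSubgraph G T
  rich-root⇒contains v₀ rich₀ = complete (n T) base (Core.closed (proj₁ (proj₂ walks))) (m≤n+m (n T) _)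
    where
    core : Core ((r , v₀) ∷ [])
    core = record
      { emb    = root r v₀
      ; rich   = λ { (here refl) → rich₀ }
      ; closed = λ { (here refl) → r-closed r-top }
      }
      where
      -- This is the purpose of `r-top`: the invariant holds for the single vertex `r`.
      r-closed : ∀ {D} → InU T r ⊎ (∀ y → ¬ Edge T y r) → Closed D r
      r-closed (inj₁ r∈U)  = inj₁ r∈U
      r-closed (inj₂ none) = inj₂ λ y e → contradiction e (none y)
    walks = embed-walks core (here refl) (allFin (n T))
    level-U : ∀ u → InU T u → level u ≡ 0
    level-U u u∈U = level-walk {P = λ _ → ⊤} u∈U (here tt)
    base : Base (proj₁ walks)
    base = record
      { emb  = Core.emb (proj₁ (proj₂ walks))
      ; U⊆   = λ {u} → proj₂ (proj₂ (proj₂ walks)) (∈-allFin u)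
      ; legs = λ {u} {w} u∈U p∈ → subst (λ i → RichG i w) (level-U u u∈U) (Core.rich (proj₁ (proj₂ walks)) p∈)
      ; r∈   = proj₁ (proj₂ (proj₂ walks)) (here refl)
      }

-- The choice of the root and the conclusion

module _ (T : Digraph) {h : Fin (n T) → ℤ} (isH : IsHeightFunction T h) where

  Top : Fin (n T) → Set
  Top r = InU T r ⊎ (∀ y → ¬ Edge T y r)

  -- Going backwards along edges lowers the height, so no vertex repeats and the climb ends after at
  -- most `n T` steps.
  climb : ∀ fuel {q} visited → n T ≤ length visited + fuel → Unique visited →
    (∀ {z} → z ∈ visited → h q ℤ.< h z) →
    ∃ λ r → Top r × DWalk T (λ _ → ⊤) r q
  climb fuel {q} visited enough u below with 2 ≤? indeg T q | any? (λ y → adj T y q Bool.≟ true)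
  ... | yes q∈U | _      = q , inj₁ q∈U , here tt
  ... | no _    | no top = q , inj₂ (λ y e → top (y , e)) , here tt
  ... | no _    | yes (y , e) = next fuel enough
    where
    u⁺ : Unique (q ∷ visited)
    u⁺ = fresh∷unique (λ q∈ → ℤ.<-irrefl refl (below q∈)) u
    y<q : h y ℤ.< h q
    y<q = ℤ.suc[i]≤j⇒i<j (ℤ.≤-reflexive (trans (ℤ.+-comm (ℤ.+ 1) (h y)) (sym (isH y q e))))
    below⁺ : ∀ {z} → z ∈ q ∷ visited → h y ℤ.< h z
    below⁺ (here refl) = y<q
    below⁺ (there z∈)  = ℤ.<-trans y<q (below z∈)
    append : ∀ {r} → DWalk T (λ _ → ⊤) r y → DWalk T (λ _ → ⊤) r q
    append (here _)     = fwd tt e (here tt)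
    append (fwd _ e′ w) = fwd tt e′ (append w)
    next : ∀ fuel → n T ≤ length visited + fuel → ∃ λ r → Top r × DWalk T (λ _ → ⊤) r q
    next zero enough = contradiction
      (≤-trans (s≤s (≤-trans enough (≤-reflexive (+-identityʳ _)))) (unique-length≤n u⁺)) (<-irrefl refl)
    next (suc fuel) enough =
      let (r , top , w) = climb fuel (q ∷ visited) (≤-trans enough (≤-reflexive (+-suc (length visited) fuel))) u⁺ below⁺
      in r , top , append w

DWalk-++ : ∀ {T P x y z} → DWalk T (λ _ → ⊤) x y → DWalk T P y z → DWalk T (λ _ → ⊤) x z
DWalk-++ (here _)     (here _)     = here tt
DWalk-++ (here _)     (fwd _ e w′) = fwd tt e (DWalk-++ (here tt) w′)
DWalk-++ (fwd _ e w)  w′           = fwd tt e (DWalk-++ w w′)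

U-source : ∀ T → IsOrientedTree T → IsOutArborescenceOn T (InMinSubtree T) →
  ∃ λ r → ∀ u → InU T u → DWalk T (InMinSubtree T) r u
-- Every vertex of `U` lies in the minimal subtree, so `U` is empty and any vertex serves.
U-source T tree (inj₁ empty) =
  fromℕ< (IsOrientedTree.nonempty tree) , λ u u∈U → ⊥-elim (empty u λ X U⊆X _ → U⊆X u u∈U)
U-source T tree (inj₂ (r , _ , reach)) = r , λ u u∈U → reach u λ X U⊆X _ → U⊆X u u∈U

U-height : ∀ T {h : Fin (n T) → ℤ} → (∀ u v → InU T u → InU T v → h u ≡ h v) →
  ∃ λ H → ∀ u → InU T u → h u ≡ H
U-height T {h} level with any? (λ u → 2 ≤? indeg T u)
... | yes (u₀ , u₀∈U) = h u₀ , λ u u∈U → level u u₀ u∈U u₀∈U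
... | no empty        = ℤ.+ 0 , λ u u∈U → contradiction (u , u∈U) empty

theorem1p5 : (T : Digraph) → IsOrientedTree T → IsGrounded T →
    IsOutArborescenceOn T (InMinSubtree T) →
    Σ ℕ λ d → (G : Digraph) → 1 ≤ n G → MinOutDegGeq G d → ContainsSubgraph G T
theorem1p5 T tree (h , isH , grounded) arborescence
  with U-source T tree arborescence | U-height T grounded
... | q , reach | H , h-U with climb T isH (n T) {q} [] ≤-refl [] (λ ())
-- The first summand yields a vertex rich enough to be the image of `r`; the second leaves a free
-- out-neighbour at every vertex of `G`.
... | r , top , r→q = richBound m i + suc m , contains
  where
  m = n T
  i = ℤ.∣ H ℤ.- h r ∣
  contains : (G : Digraph) → 1 ≤ n G → MinOutDegGeq G (richBound m i + suc m) → ContainsSubgraph G T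
  contains G nonempty deg =
    let (v₀ , _ , rich₀) = rich-unavoidable (adj G) m i (λ _ → true) (fromℕ< nonempty) refl
                             (λ u _ → ≤-trans (m≤m+n _ _) (≤-trans (deg u) (≤-reflexive (outdeg≡ u))))
    in Greedy.rich-root⇒contains T G tree h isH H h-U r (λ u u∈U → DWalk-++ r→q (reach u u∈U)) top
         (λ u → ≤-trans (m≤n+m _ _) (deg u)) v₀ rich₀
    where
    outdeg≡ : ∀ u → outdeg G u ≡ sum (λ v → ⟦ adj G u v ∧ true ⟧)
    outdeg≡ u = trans (sum-allFin (λ v → ⟦ adj G u v ⟧)) (sum-cong-≗ (λ v → cong ⟦_⟧ (sym (Bool.∧-identityʳ (adj G u v)))))
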